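{- Let $A,B$ be sets and $\phi\subseteq A\times B$ a relation from $A$ to $B$. A complete lattice $X$ is isomorphic to $\mathsf{K}\phi$ if, and only if, there exist a $\bigvee$-dense map $f:B\to X$ and a $\bigwedge$-dense map $g:A\to X$ such that for all $b\in B$ and all $a\in A$: $b(\neg\phi)a\iff f(b)\leq g(a)$ in $X$.
   Context: For a relation $\phi$ from $A$ to $B$, define $\phi^*:\mathbf{2}^B\to\mathbf{2}^A$ and $\phi_*:\mathbf{2}^A\to\mathbf{2}^B$ between power sets (ordered by inclusion) by $\phi^*(V)=\{x\in A\mid\exists y\in V:\ x\phi y\}$ and $\phi_*(U)=\{y\in B\mid\forall x\in A:\ x\phi y\Rightarrow x\in U\}$. They form a Galois connection $\phi^*\dashv\phi_*$, and $\mathsf{K}\phi=\{V\subseteq B\mid \phi_*\phi^*(V)=V\}$, ordered by inclusion, is a complete lattice. The complement $\neg\phi$ is the relation from $B$ to $A$ given by $b(\neg\phi)a\iff\neg(a\phi b)$. A map $f:A\to Y$ from a set $A$ to a complete lattice $Y$ is $\bigvee$-dense (resp. $\bigwedge$-dense) if every $y\in Y$ is the join (resp. meet) of $\{f(x_i)\}_{i\in I}$ for some family $\{x_i\}_{i\in I}\subseteq A$ (possibly empty). -}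

module Defs where

open import Level using (Level; _⊔_; suc)
open import Data.Product using (Σ; Σ-syntax; ∃; ∃-syntax; _×_; _,_; proj₁)
open import Function using (_∘_)
open import Relation.Binary.Bundles using (Poset)
open import Relation.Binary.Core using (REL)
open import Relation.Binary.Morphism.Structures using (IsOrderIsomorphism)
import Relation.Binary.Construct.On as On
open import Relation.Nullary using (¬_)
open import Relation.Unary using (Pred; _∈_; _≐_)
open import Relation.Unary.Relation.Binary.Subset using (⊆-poset)

private
  variable
    a b r i c ℓ₁ ℓ₂ c′ ℓ₁′ ℓ₂′ : Level

------------------------------------------------------------------------
-- Complete lattices

module _ (P : Poset c ℓ₁ ℓ₂) where
  open Poset P

  IsJoin : {I : Set i} → (I → Carrier) → Carrier → Set (i ⊔ c ⊔ ℓ₂)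
  IsJoin x y = (∀ i → x i ≤ y) × (∀ z → (∀ i → x i ≤ z) → y ≤ z)

  IsMeet : {I : Set i} → (I → Carrier) → Carrier → Set (i ⊔ c ⊔ ℓ₂)
  IsMeet x y = (∀ i → y ≤ x i) × (∀ z → (∀ i → z ≤ x i) → z ≤ y)

-- Families are indexed by sets at the level of the carrier, so that every
-- subset S : Pred Carrier c is covered (take the index set Σ Carrier S).
-- Under excluded middle this gives joins and meets of subsets and families
-- at every level, since each proposition is then equivalent to one in Set.
record CompleteLattice (c ℓ₁ ℓ₂ : Level) : Set (suc (c ⊔ ℓ₁ ⊔ ℓ₂)) where
  field
    poset : Poset c ℓ₁ ℓ₂

  open Poset poset public

  field
    join : {I : Set c} (x : I → Carrier) → ∃[ y ] IsJoin poset x y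
    meet : {I : Set c} (x : I → Carrier) → ∃[ y ] IsMeet poset x y

infix 4 _≅_

_≅_ : Poset c ℓ₁ ℓ₂ → Poset c′ ℓ₁′ ℓ₂′ → Set (c ⊔ ℓ₁ ⊔ ℓ₂ ⊔ c′ ⊔ ℓ₁′ ⊔ ℓ₂′)
P ≅ Q = ∃ (IsOrderIsomorphism P._≈_ Q._≈_ P._≤_ Q._≤_)
  where
  module P = Poset P
  module Q = Poset Q

-- The maps are functions on sets A with propositional equality. The index
-- set I may be empty; the level of A suffices for it, as for subsets of A.
module _ {A : Set a} (Y : CompleteLattice c ℓ₁ ℓ₂) where
  open CompleteLattice Y

  ⋁-Dense : (A → Carrier) → Set (suc a ⊔ c ⊔ ℓ₂)
  ⋁-Dense f = ∀ y → Σ[ I ∈ Set a ] Σ[ x ∈ (I → A) ] IsJoin poset (f ∘ x) y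

  ⋀-Dense : (A → Carrier) → Set (suc a ⊔ c ⊔ ℓ₂)
  ⋀-Dense f = ∀ y → Σ[ I ∈ Set a ] Σ[ x ∈ (I → A) ] IsMeet poset (f ∘ x) y

------------------------------------------------------------------------
-- The lattice of a relation

-- Both power sets use the level a ⊔ b ⊔ r, at which _^* and _⁎ are maps
-- between them.
module _ {A : Set a} {B : Set b} where

  _^* : REL A B r → Pred B (a ⊔ b ⊔ r) → Pred A (a ⊔ b ⊔ r)
  (φ ^*) V x = ∃[ y ] (y ∈ V × φ x y)

  _⁎ : REL A B r → Pred A (a ⊔ b ⊔ r) → Pred B (a ⊔ b ⊔ r)
  (φ ⁎) U y = ∀ x → φ x y → x ∈ U

  complement : REL A B r → REL B A r
  complement φ y x = ¬ φ x y

  K : REL A B r → Poset (suc (a ⊔ b ⊔ r)) (a ⊔ b ⊔ r) (a ⊔ b ⊔ r)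
  K {r = r} φ =
    On.poset (⊆-poset B (a ⊔ b ⊔ r))
      (proj₁ {B = λ V → (φ ⁎) ((φ ^*) V) ≐ V})

{-# OPTIONS --safe #-}
module Submission where

-- The lattice K φ consists of the fixed points V = φ⁎ (φ^* V), and these are
-- exactly the sets of the form φ⁎ U.
--
-- From an isomorphism with K φ, the map f is transported from the principal
-- closed sets b ↦ φ⁎ (φ^* {b}), and g from the sets a ↦ φ⁎ (A ∖ {a}), which
-- is {y | ¬ a φ y}.  A closed set V is the union of the principal closed sets
-- of its elements, and the intersection of the φ⁎ (A ∖ {a}) over the
-- a ∉ φ^* V, because φ⁎ turns intersections into intersections.  Finally
-- φ⁎ (φ^* {b}) ⊆ φ⁎ (A ∖ {a}) holds exactly when b lies in the latter set,
-- that is, when ¬ a φ b.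
--
-- Conversely, given f and g, the isomorphism sends x to its trace
-- {b | f b ≤ x}.  The trace is closed because x is a meet of values of g
-- (`trace-closed`), and x is recovered from it because x is a join of values
-- of f (`trace-cancel`).  A closed set V is the trace of the join of f over V
-- (`join-above`, `trace-of-join`): if a ∉ φ^* V, then g a bounds f on V, hence
-- bounds f b for every b in the trace, so ¬ a φ b.
--
-- Excluded middle serves twice: for the arguments by contradiction just
-- given, and to replace a proposition by an equivalent one at level zero, so
-- that subsets and index sets live at the prescribed universe levels.

open import Defs
open import Level using (Level; Lift; lift; lower; _⊔_)
open import Axiom.ExcludedMiddle using (ExcludedMiddle)
open import Data.Product using (Σ; Σ-syntax; ∃-syntax; _×_; _,_; proj₁; proj₂)
open import Function.Base using (_∘_)
open import Function.Bundles using (_⇔_; mk⇔; module Equivalence)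
open import Relation.Binary.Bundles using (Poset)
open import Relation.Binary.Core using (REL)
open import Relation.Binary.Morphism.Structures using (IsOrderMonomorphism; IsOrderIsomorphism)
open import Relation.Binary.PropositionalEquality using (_≢_; refl)
open import Relation.Nullary.Decidable using (True; toWitness; fromWitness; decidable-stable)
open import Relation.Unary using (Pred; _∈_; _∉_; _⊆_; _≐_)

private
  variable
    a b r i c ℓ₁ ℓ₂ c′ ℓ₁′ ℓ₂′ : Level

------------------------------------------------------------------------
-- Order embeddings reflect joins and meets

module _ (P : Poset c ℓ₁ ℓ₂) (Q : Poset c′ ℓ₁′ ℓ₂′) where
  private
    module P = Poset P
    module Q = Poset Q

  -- The image of the family u only has to agree with v up to equality in Q.
  module _ {h : P.Carrier → Q.Carrier}
           (h-mono : IsOrderMonomorphism P._≈_ Q._≈_ P._≤_ Q._≤_ h)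
           {I : Set i} {u : I → P.Carrier} (v : I → Q.Carrier)
           (hu≈v : ∀ j → h (u j) Q.≈ v j) {y : P.Carrier} where
    open IsOrderMonomorphism h-mono

    reflect-join : IsJoin Q v (h y) → IsJoin P u y
    reflect-join (upper , least) =
      (λ j → cancel (Q.trans (Q.reflexive (hu≈v j)) (upper j))) ,
      (λ z u≤z → cancel (least (h z) λ j →
        Q.trans (Q.reflexive (Q.Eq.sym (hu≈v j))) (mono (u≤z j))))

    reflect-meet : IsMeet Q v (h y) → IsMeet P u y
    reflect-meet (below , greatest) =
      (λ j → cancel (Q.trans (below j) (Q.reflexive (Q.Eq.sym (hu≈v j))))) ,
      (λ z z≤u → cancel (greatest (h z) λ j →
        Q.trans (mono (z≤u j)) (Q.reflexive (hu≈v j))))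

------------------------------------------------------------------------
-- Closed sets of a relation

module ClosedSets {A : Set a} {B : Set b} (φ : REL A B r) where

  module K = Poset (K φ)

  -- The closed set φ⁎ U; closedness is a triangle identity of φ^* ⊣ φ⁎.
  closed : Pred A (a ⊔ b ⊔ r) → K.Carrier
  closed U = (φ ⁎) U , to , from
    where
    to : (φ ⁎) ((φ ^*) ((φ ⁎) U)) ⊆ (φ ⁎) U
    to y∈ x xφy with y′ , y′∈ , xφy′ ← y∈ x xφy = y′∈ x xφy′

    from : (φ ⁎) U ⊆ (φ ⁎) ((φ ^*) ((φ ⁎) U))
    from {y} y∈ x xφy = y , y∈ , xφy

  -- φ⁎ (φ^* {y}), the least closed set containing y.
  principal : B → K.Carrier
  principal y = closed λ x → Lift (a ⊔ b ⊔ r) (φ x y)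

  -- φ⁎ (A ∖ {x}), the greatest closed set whose elements are not related to x.
  coprincipal : A → K.Carrier
  coprincipal x = closed λ x′ → Lift (a ⊔ b ⊔ r) (x′ ≢ x)

  ∈-principal : ∀ y → y ∈ proj₁ (principal y)
  ∈-principal y x xφy = lift xφy

  principal-least : ∀ (V : K.Carrier) {y} → y ∈ proj₁ V → principal y K.≤ V
  principal-least (V , ⊆V , _) {y} y∈V y′∈ =
    ⊆V λ x xφy′ → y , y∈V , lower (y′∈ x xφy′)

  ∈-coprincipal : ∀ {x y} → y ∈ proj₁ (coprincipal x) ⇔ complement φ y x
  ∈-coprincipal = mk⇔
    (λ y∈ xφy → lower (y∈ _ xφy) refl)
    (λ ¬xφy x′ x′φy → lift λ { refl → ¬xφy x′φy })

  principal≤coprincipal : ∀ y x → complement φ y x ⇔ (principal y K.≤ coprincipal x)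
  principal≤coprincipal y x = mk⇔ {B = principal y K.≤ coprincipal x}
    (λ ¬xφy → principal-least (coprincipal x) (from ¬xφy))
    (λ p≤c → to (p≤c (∈-principal y)))
    where open Equivalence (∈-coprincipal {x} {y})

  module _ (em : ∀ ℓ → ExcludedMiddle ℓ) where

    principal-dense : ∀ V → Σ[ I ∈ Set b ] Σ[ y ∈ (I → B) ] IsJoin (K φ) (principal ∘ y) V
    principal-dense V =
      (Σ[ y ∈ B ] True (em _ {y ∈ proj₁ V})) , proj₁ ,
      (λ (_ , y∈V) → principal-least V (toWitness y∈V)) ,
      (λ Z p≤Z {y} y∈V → p≤Z (y , fromWitness y∈V) (∈-principal y))

    coprincipal-dense : ∀ V → Σ[ I ∈ Set a ] Σ[ x ∈ (I → A) ] IsMeet (K φ) (coprincipal ∘ x) V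
    coprincipal-dense (V , ⊆V , _) =
      (Σ[ x ∈ A ] True (em _ {x ∉ (φ ^*) V})) , proj₁ ,
      (λ (_ , x∉) {y} y∈V → Equivalence.from ∈-coprincipal
        λ xφy → toWitness x∉ (y , y∈V , xφy)) ,
      (λ Z Z≤c y∈Z → ⊆V λ x xφy → decidable-stable (em _) λ x∉ →
        Equivalence.to ∈-coprincipal (Z≤c (x , fromWitness x∉) y∈Z) xφy)

------------------------------------------------------------------------
-- The isomorphism induced by a pair of dense maps

module Trace
  (em : ∀ ℓ → ExcludedMiddle ℓ) {A : Set a} {B : Set b} (φ : REL A B r)
  (X : CompleteLattice c ℓ₁ ℓ₂)
  {f : B → CompleteLattice.Carrier X} {g : A → CompleteLattice.Carrier X}
  (f-dense : ⋁-Dense X f) (g-dense : ⋀-Dense X g)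
  (¬φ⇔≤ : ∀ y x → complement φ y x ⇔ CompleteLattice._≤_ X (f y) (g x))
  where

  open CompleteLattice X

  private
    module K = Poset (K φ)

    ¬φ⇒≤ : ∀ {y x} → complement φ y x → f y ≤ g x
    ¬φ⇒≤ = Equivalence.to (¬φ⇔≤ _ _)

    ≤⇒¬φ : ∀ {y x} → f y ≤ g x → complement φ y x
    ≤⇒¬φ = Equivalence.from (¬φ⇔≤ _ _)

  -- The set {y | f y ≤ x}, with its membership predicate resized to the level
  -- of the power set of B.
  trace : Carrier → Pred B (a ⊔ b ⊔ r)
  trace x y = Lift (a ⊔ b ⊔ r) (True (em _ {f y ≤ x}))

  ∈-trace⁺ : ∀ {x y} → f y ≤ x → y ∈ trace x
  ∈-trace⁺ fy≤x = lift (fromWitness fy≤x)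

  ∈-trace⁻ : ∀ {x y} → y ∈ trace x → f y ≤ x
  ∈-trace⁻ y∈ = toWitness (lower y∈)

  -- With x a meet of values g (α j), it suffices that ¬ α j φ y for every j,
  -- since α j is related to no element of the trace.
  trace-closed : ∀ x → (φ ⁎) ((φ ^*) (trace x)) ≐ trace x
  trace-closed x with _ , α , x≤gα , greatest ← g-dense x =
    (λ y∈ → ∈-trace⁺ (greatest _ λ j → ¬φ⇒≤ λ αφy →
      let y′ , y′∈ , αφy′ = y∈ (α j) αφy
      in  ≤⇒¬φ (trans (∈-trace⁻ y′∈) (x≤gα j)) αφy′)) ,
    (λ {y} y∈ _ xφy → y , y∈ , xφy)

  toK : Carrier → K.Carrier
  toK x = trace x , trace-closed x

  trace-mono : ∀ {x x′} → x ≤ x′ → trace x ⊆ trace x′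
  trace-mono x≤x′ y∈ = ∈-trace⁺ (trans (∈-trace⁻ y∈) x≤x′)

  trace-cancel : ∀ {x x′} → trace x ⊆ trace x′ → x ≤ x′
  trace-cancel {x} {x′} t⊆t′ with _ , β , fβ≤x , least ← f-dense x =
    least x′ λ j → ∈-trace⁻ (t⊆t′ (∈-trace⁺ (fβ≤x j)))

  -- The image of V under f, as a type at the level of the carrier of X.
  Image : Pred B (a ⊔ b ⊔ r) → Set c
  Image V = Σ[ w ∈ Carrier ] True (em _ {∃[ y ] (y ∈ V × w ≈ f y)})

  -- Joins in X are only given for families indexed at the level of its carrier,
  -- so the join of f over V is taken over the image of V.
  join-above : ∀ (V : Pred B (a ⊔ b ⊔ r)) →
    ∃[ x ] IsJoin poset {I = Σ B V} (f ∘ proj₁) x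
  join-above V with x , upper , least ← join {I = Image V} proj₁ =
    x ,
    (λ (y , y∈V) → upper (f y , fromWitness (y , y∈V , Eq.refl))) ,
    (λ z f≤z → least z λ (w , w∈) →
      let y , y∈V , w≈fy = toWitness w∈
      in  trans (reflexive w≈fy) (f≤z (y , y∈V)))

  -- An element x related to some y in the trace lies in φ^* V: otherwise g x
  -- would be an upper bound of f on V, hence of f y.
  trace-of-join : ∀ ((V , _) : K.Carrier) {x} →
    IsJoin poset {I = Σ B V} (f ∘ proj₁) x → trace x ≐ V
  trace-of-join (V , ⊆V , _) (upper , least) =
    (λ y∈ → ⊆V λ x xφy → decidable-stable (em _) λ x∉ →
      ≤⇒¬φ (trans (∈-trace⁻ y∈)
                  (least (g x) λ (y′ , y′∈V) → ¬φ⇒≤ λ xφy′ → x∉ (y′ , y′∈V , xφy′)))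
           xφy) ,
    (λ {y} y∈V → ∈-trace⁺ (upper (y , y∈V)))

  trace-iso : poset ≅ K φ
  trace-iso = toK , record
    { isOrderMonomorphism = record
      { isOrderHomomorphism = record
        { cong = cong
        ; mono = trace-mono
        }
      ; injective = λ (t⊆t′ , t′⊆t) → antisym (trace-cancel t⊆t′) (trace-cancel t′⊆t)
      ; cancel = trace-cancel
      }
    ; surjective = λ V →
        let x , x-join = join-above (proj₁ V)
        in  x , λ {z} z≈x → K.Eq.trans {toK z} {toK x} {V} (cong z≈x) (trace-of-join V x-join)
    }
    where
    cong : ∀ {x x′} → x ≈ x′ → trace x ≐ trace x′
    cong x≈x′ = trace-mono (reflexive x≈x′) , trace-mono (reflexive (Eq.sym x≈x′))

------------------------------------------------------------------------
-- The dense maps induced by an isomorphism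

module FromIso
  (em : ∀ ℓ → ExcludedMiddle ℓ) {A : Set a} {B : Set b} (φ : REL A B r)
  (X : CompleteLattice c ℓ₁ ℓ₂) (iso : CompleteLattice.poset X ≅ K φ)
  where

  open CompleteLattice X
  open ClosedSets φ
  private
    h = proj₁ iso

  open IsOrderIsomorphism (proj₂ iso)
    using (isOrderMonomorphism; mono; cancel; surjective)

  -- A section of h; it serves as the inverse because h is an order embedding.
  h⁻¹ : K.Carrier → Carrier
  h⁻¹ V = proj₁ (surjective V)

  h∘h⁻¹ : ∀ V → h (h⁻¹ V) K.≈ V
  h∘h⁻¹ V = proj₂ (surjective V) Eq.refl

  -- The preimages of the principal and of the coprincipal closed sets.
  f : B → Carrier
  f y = h⁻¹ (principal y)

  g : A → Carrier
  g x = h⁻¹ (coprincipal x)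

  f-dense : ⋁-Dense X f
  f-dense x with I , y , y-join ← principal-dense em (h x) =
    I , y , reflect-join poset (K φ) isOrderMonomorphism
      (principal ∘ y) (λ j → h∘h⁻¹ (principal (y j))) y-join

  g-dense : ⋀-Dense X g
  g-dense x with I , α , α-meet ← coprincipal-dense em (h x) =
    I , α , reflect-meet poset (K φ) isOrderMonomorphism
      (coprincipal ∘ α) (λ j → h∘h⁻¹ (coprincipal (α j))) α-meet

  ¬φ⇔≤ : ∀ y x → complement φ y x ⇔ (f y ≤ g x)
  ¬φ⇔≤ y x = mk⇔
    (λ ¬xφy → cancel λ z∈ →
      proj₂ (h∘h⁻¹ (coprincipal x)) (to ¬xφy (proj₁ (h∘h⁻¹ (principal y)) z∈)))
    (λ fy≤gx → from λ z∈ →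
      proj₁ (h∘h⁻¹ (coprincipal x)) (mono fy≤gx (proj₂ (h∘h⁻¹ (principal y)) z∈)))
    where open Equivalence (principal≤coprincipal y x)

------------------------------------------------------------------------
-- The characterisation of K φ

theorem1p4 : (∀ ℓ → ExcludedMiddle ℓ) →
    ∀ {a b r c ℓ₁ ℓ₂ : Level} {A : Set a} {B : Set b} (φ : REL A B r)
    (X : CompleteLattice c ℓ₁ ℓ₂) →
    let open CompleteLattice X in
    (poset ≅ K φ) ⇔
    (Σ[ f ∈ (B → Carrier) ] Σ[ g ∈ (A → Carrier) ]
    (⋁-Dense X f × ⋀-Dense X g ×
    (∀ y x → complement φ y x ⇔ (f y ≤ g x))))
theorem1p4 em φ X = mk⇔
  (λ iso → f em φ X iso , g em φ X iso ,
           f-dense em φ X iso , g-dense em φ X iso , ¬φ⇔≤ em φ X iso)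
  (λ (f , g , f-dense , g-dense , ¬φ⇔≤) → Trace.trace-iso em φ X f-dense g-dense ¬φ⇔≤)
  where open FromIso
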